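{- For each interaction net $R$ there exists a unique AC net $R'$ of the form $(\sigma_A,0,\sigma_c)$ such that the $\mathrm{Ex}$-collapse of $R'$ is $R$.
   Context: **Partial injections.** A partial injection $f$ is a bijection from a subset $\mathrm{dom}(f)\subseteq\mathbb{N}$ onto a subset $\mathrm{codom}(f)\subseteq\mathbb{N}$; $f:A\twoheadrightarrow B$ means $\mathrm{dom}(f)=A$, $\mathrm{codom}(f)=B$; $f^\star$ is the inverse; $0$ is the empty one; products denote composition of partial functions. $f,g$ are disjoint if their domains are disjoint and their codomains are disjoint; then $f+g$ is their union. A partial permutation is a partial injection with $\mathrm{dom}=\mathrm{codom}$. A $w$-permutation is an involutive partial permutation of finite domain. **Execution.** For $f:A\uplus B\twoheadrightarrow C\uplus D$ and $g:D\twoheadrightarrow B$ with finite domains, $\mathrm{Ex}(f,g):A\twoheadrightarrow C$ sends $x\in A$ to $f(gf)^k(x)$, where $k$ is the unique integer $\ge 0$ with $f(gf)^k(x)\in C$. **Ex-composition.** Let $\sigma,\tau$ be disjoint $w$-permutations and $f$ a partial injection with $\mathrm{dom}(f)\subseteq\mathrm{dom}(\sigma)$, $\mathrm{codom}(f)\subseteq\mathrm{dom}(\tau)$. Put $\sigma\leftrightsquigarrow^f_0\tau=\mathrm{Ex}(\sigma+\tau,f+f^\star)$. For each $x\in\mathrm{dom}(f)$ such that $(f^\star\tau f\sigma)^n(x)=x$ for some $n\ge1$, let $O_x=\{(f^\star\tau f\sigma)^i(x): i\in\mathbb{N}\}$ and $O'_x=\{(f\sigma f^\star\tau)^i(f\sigma(x)):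 i\in\mathbb{N}\}$; $O_x\cup O'_x$ is called a double orbit. Let $Q$ be the set of minima of all double orbits. The full Ex-composition $\sigma\leftrightsquigarrow^f\tau$ has domain $\mathrm{dom}(\sigma\leftrightsquigarrow^f_0\tau)\uplus Q$, agrees with $\sigma\leftrightsquigarrow^f_0\tau$ on its domain, and fixes every element of $Q$. **Interaction nets.** Fix a countable set $\mathcal{S}$ of symbols and an arity function $\mathrm{ar}:\mathcal{S}\to\mathbb{N}$. An interaction net is a pair $R=(\sigma_w,\sigma_c)$ where $\sigma_w$ is a $w$-permutation, $P(R)$ is the set of its non-fixed points, and $\sigma_c$ is a partial permutation with domain contained in $P(R)$ such that each orbit $o$ of $\sigma_c$ comes with a chosen element of $o$ and a label $l(o)\in\mathcal{S}$ with $|o|=\mathrm{ar}(l(o))+1$. **AC nets.** An Axiom/Cut net (AC net) is a tuple $R=(\sigma_A,\sigma_C,\sigma_c)$ where: $\sigma_A,\sigma_C$ are $w$-permutations with $\mathrm{dom}(\sigma_C)\subseteq\mathrm{dom}(\sigma_A)$; $\sigma_C$ has no fixed points; if $(a\ b)$ is an orbit of $\sigma_C$ then there exist $c\ne a$ and $d\ne b$ such that $(c\ a)$ and $(b\ d)$ are orbits of $\sigma_A$; writing $P_l(R)$ for the fixed points of $\sigma_A$ and $P(R)=\mathrm{dom}(\sigma_A)-\mathrm{dom}(\sigma_C)-P_l(R)$, $\sigma_c$ is a permutation of a subset $P_c(R)\subseteq P(R)$ such that each orbit $o$ of $\sigma_c$ comes with a chosen element of $o$ and a label $l(o)\in\mathcal{S}$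 with $|o|=\mathrm{ar}(l(o))+1$. **Ex-collapse.** The Ex-collapse of an AC net $(\sigma_A,\sigma_C,\sigma_c)$ is the interaction net $(\sigma_A\leftrightsquigarrow^f f\sigma_C f^\star,\ \sigma_c)$, where $f$ is a partial injection with $\mathrm{dom}(f)=\mathrm{dom}(\sigma_C)$ and $\mathrm{codom}(f)\cap\mathrm{dom}(\sigma_A)=\emptyset$. When $\sigma_C=0$, necessarily $f=0$, so the Ex-collapse is $(\sigma_A\leftrightsquigarrow^0 0,\ \sigma_c)$. -}

module Defs where

open import Data.Empty using (⊥-elim) renaming (⊥ to Absurd)
open import Data.List.Base using (List; length)
import Data.List.Membership.Propositional as List
open import Data.List.Relation.Unary.Unique.Propositional using (Unique)
open import Data.Nat.Base using (ℕ; zero; suc; _≤_)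
open import Data.Product.Base using (∃; ∃₂; _×_; _,_; proj₁; proj₂)
open import Data.Sum.Base using (_⊎_; inj₁; inj₂)
open import Function.Bundles using (_↣_) renaming (_⇔_ to _iff_)
open import Level using (0ℓ) renaming (suc to lsuc)
open import Relation.Binary.Core using (Rel; _⇔_)
open import Relation.Binary.PropositionalEquality
  using (_≡_; _≢_; refl; sym; subst)
open import Relation.Unary using (Pred; _∈_; _∉_; _⊆_; _≐_; _⊥_; _∪_)

infix  4 _≈_
infixl 6 _+_by_
infixr 7 _∘_
infixr 8 _^_
infix  9 _⋆

------------------------------------------------------------------------
-- Subsets of ℕ

HasSize : Pred ℕ 0ℓ → ℕ → Set
HasSize P n = ∃ λ (xs : List ℕ) →
  Unique xs × length xs ≡ n × (∀ x → (x List.∈ xs) iff (x ∈ P))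

Finite : Pred ℕ 0ℓ → Set
Finite P = ∃ (HasSize P)

IsMinimumOf : Pred ℕ 0ℓ → Pred ℕ 0ℓ
IsMinimumOf P m = m ∈ P × (∀ {x} → x ∈ P → m ≤ x)

------------------------------------------------------------------------
-- Partial injections

-- A bijection between two subsets of ℕ, given by its graph:
-- graph x y means that x is in the domain and is sent to y.
record PartialInjection : Set (lsuc 0ℓ) where
  field
    graph      : Rel ℕ 0ℓ
    functional : ∀ {x y z} → graph x y → graph x z → y ≡ z
    injective  : ∀ {x y z} → graph x z → graph y z → x ≡ y

  dom : Pred ℕ 0ℓ
  dom x = ∃ λ y → graph x y

  codom : Pred ℕ 0ℓ
  codom y = ∃ λ x → graph x y

open PartialInjection public

-- Equality of partial functions is equality of graphs.
_≈_ : PartialInjection → PartialInjection → Set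
f ≈ g = graph f ⇔ graph g

𝟘 : PartialInjection
𝟘 = record
  { graph      = λ _ _ → Absurd
  ; functional = λ ()
  ; injective  = λ ()
  }

idOn : Pred ℕ 0ℓ → PartialInjection
idOn P = record
  { graph      = λ x y → x ∈ P × x ≡ y
  ; functional = λ { (_ , refl) (_ , refl) → refl }
  ; injective  = λ { (_ , refl) (_ , refl) → refl }
  }

_⋆ : PartialInjection → PartialInjection
f ⋆ = record
  { graph      = λ x y → graph f y x
  ; functional = injective f
  ; injective  = functional f
  }

-- f ∘ g applies g first.
_∘_ : PartialInjection → PartialInjection → PartialInjection
f ∘ g = record
  { graph      = λ x z → ∃ λ y → graph g x y × graph f y z
  ; functional = λ { {z = z} (_ , a , b) (_ , c , d) →
      functional f b (subst (λ u → graph f u z) (functional g c a) d) }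
  ; injective  = λ { {y = y} (_ , a , b) (_ , c , d) →
      injective g a (subst (graph g y) (injective f d b) c) }
  }

-- The zeroth power is the identity on all of ℕ.
_^_ : PartialInjection → ℕ → PartialInjection
f ^ zero  = record
  { graph      = _≡_
  ; functional = λ { refl refl → refl }
  ; injective  = λ { refl refl → refl }
  }
f ^ suc n = f ∘ f ^ n

Disjoint : PartialInjection → PartialInjection → Set
Disjoint f g = (dom f ⊥ dom g) × (codom f ⊥ codom g)

_+_by_ : (f g : PartialInjection) → Disjoint f g → PartialInjection
f + g by (d , c) = record
  { graph      = λ x y → graph f x y ⊎ graph g x y
  ; functional = λ
      { (inj₁ p) (inj₁ q) → functional f p q
      ; (inj₁ p) (inj₂ q) → ⊥-elim (d ((_ , p) , (_ , q)))
      ; (inj₂ p) (inj₁ q) → ⊥-elim (d ((_ , q) , (_ , p)))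
      ; (inj₂ p) (inj₂ q) → functional g p q }
  ; injective  = λ
      { (inj₁ p) (inj₁ q) → injective f p q
      ; (inj₁ p) (inj₂ q) → ⊥-elim (c ((_ , p) , (_ , q)))
      ; (inj₂ p) (inj₁ q) → ⊥-elim (c ((_ , q) , (_ , p)))
      ; (inj₂ p) (inj₂ q) → injective g p q }
  }

-- Only used where dom f is finite, or f is a permutation with x on a
-- finite cycle, so that forward iterates exhaust the orbit of x.
Orbit : PartialInjection → ℕ → Pred ℕ 0ℓ
Orbit f x y = ∃ λ i → graph (f ^ i) x y

FixedPoints : PartialInjection → Pred ℕ 0ℓ
FixedPoints f x = graph f x x

IsPartialPermutation : PartialInjection → Set
IsPartialPermutation f = dom f ≐ codom f

record IsWPermutation (σ : PartialInjection) : Set where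
  field
    isPartialPermutation : IsPartialPermutation σ
    involutive           : ∀ {x} → x ∈ dom σ → graph (σ ∘ σ) x x
    finite               : Finite (dom σ)

-- (a b) is an orbit of the w-permutation σ.
IsOrbit₂ : PartialInjection → ℕ → ℕ → Set
IsOrbit₂ σ a b = graph σ a b × graph σ b a

------------------------------------------------------------------------
-- Execution

-- For f : A ⊎ B ↠ C ⊎ D and g : D ↠ B one has A = dom f ∖ codom g and
-- C = codom f ∖ dom g.
module Execution (f g : PartialInjection) where

  ExGraph : Rel ℕ 0ℓ
  ExGraph x y = x ∉ codom g × y ∉ dom g × ∃ λ k → graph (f ∘ (g ∘ f) ^ k) x y

  private
    step : ℕ → PartialInjection
    step k = f ∘ (g ∘ f) ^ k

    shift : ∀ h n {x y} → graph (h ^ suc n) x y → graph (h ^ n ∘ h) x y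
    shift h zero    (_ , refl , q) = _ , q , refl
    shift h (suc n) (_ , p , q) with shift h n p
    ... | _ , r , s = _ , r , _ , s , q

    exited : ∀ k {x y z} → graph f x y → graph (step (suc k)) x z →
             y ∈ dom g
    exited k p (_ , q , _) with shift (g ∘ f) k q
    ... | _ , (_ , s , t) , _ = _ , subst (λ u → graph g u _) (functional f s p) t

    -- Intermediate values of f lie in dom g, so the exit time is unique;
    -- symmetrically for the entry point.
    functional′ : ∀ j k {x y z} → graph (step j) x y → graph (step k) x z →
                  y ∉ dom g → z ∉ dom g → y ≡ z
    functional′ zero zero p q _ _ = functional (step zero) p q
    functional′ zero (suc k) (_ , refl , p) q y∉ _ = ⊥-elim (y∉ (exited k p q))
    functional′ (suc j) zero p (_ , refl , q) _ z∉ = ⊥-elim (z∉ (exited j q p))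
    functional′ (suc j) (suc k) (_ , p , p′) (_ , q , q′) y∉ z∉
      with shift (g ∘ f) j p | shift (g ∘ f) k q
    ... | _ , s , t | _ , s′ , t′ with functional (g ∘ f) s s′
    ... | refl = functional′ j k (_ , t , p′) (_ , t′ , q′) y∉ z∉

    injective′ : ∀ j k {x y z} → graph (step j) x z → graph (step k) y z →
                 x ∉ codom g → y ∉ codom g → x ≡ y
    injective′ zero zero p q _ _ = injective (step zero) p q
    injective′ zero (suc k) (_ , refl , p) (_ , (_ , _ , _ , _ , t) , r) x∉ _ =
      ⊥-elim (x∉ (_ , subst (graph g _) (injective f r p) t))
    injective′ (suc j) zero (_ , (_ , _ , _ , _ , t) , r) (_ , refl , p) _ y∉ =
      ⊥-elim (y∉ (_ , subst (graph g _) (injective f r p) t))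
    injective′ (suc j) (suc k) (_ , (_ , p , _ , s , t) , u)
                               (_ , (_ , q , _ , s′ , t′) , u′) x∉ y∉
      with injective f u u′
    ... | refl with injective g t t′
    ... | refl = injective′ j k (_ , p , s) (_ , q , s′) x∉ y∉

  Ex : PartialInjection
  Ex = record
    { graph      = ExGraph
    ; functional = λ (_ , y∉ , j , p) (_ , z∉ , k , q) →
        functional′ j k p q y∉ z∉
    ; injective  = λ (x∉ , _ , j , p) (y∉ , _ , k , q) →
        injective′ j k p q x∉ y∉
    }

open Execution public using (Ex)

------------------------------------------------------------------------
-- Ex-composition

record Composable (σ τ f : PartialInjection) : Set where
  field
    disjoint : Disjoint σ τ
    dom⊆     : dom f ⊆ dom σ
    codom⊆   : codom f ⊆ dom τ

-- Meant for w-permutations σ and τ, but the construction itself does not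
-- use that they are.
module ExComposition (σ τ f : PartialInjection) (c : Composable σ τ f) where
  open Composable c

  f⊥f⋆ : Disjoint f (f ⋆)
  f⊥f⋆ = (λ (p , q) → proj₁ disjoint (dom⊆ p , codom⊆ q))
       , (λ (p , q) → proj₁ disjoint (dom⊆ q , codom⊆ p))

  exComposition₀ : PartialInjection
  exComposition₀ = Ex (σ + τ by disjoint) (f + f ⋆ by f⊥f⋆)

  IsCyclic : Pred ℕ 0ℓ
  IsCyclic x =
    x ∈ dom f × ∃ λ n → 1 ≤ n × graph ((f ⋆ ∘ τ ∘ f ∘ σ) ^ n) x x

  O O′ DoubleOrbit : ℕ → Pred ℕ 0ℓ
  O  x = Orbit (f ⋆ ∘ τ ∘ f ∘ σ) x
  O′ x y = ∃ λ z → graph (f ∘ σ) x z × Orbit (f ∘ σ ∘ f ⋆ ∘ τ) z y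
  DoubleOrbit x = O x ∪ O′ x

  Q : Pred ℕ 0ℓ
  Q y = ∃ λ x → IsCyclic x × IsMinimumOf (DoubleOrbit x) y

  private
    Q⊆ : Q ⊆ dom f ∪ codom f
    Q⊆ (_ , (x∈ , _) , inj₁ (zero , refl) , _) = inj₁ x∈
    Q⊆ (_ , _ , inj₁ (suc _ , _ , _ , _ , _ , r) , _) = inj₁ (_ , r)
    Q⊆ (_ , _ , inj₂ (_ , (_ , _ , p) , zero , refl) , _) = inj₂ (_ , p)
    Q⊆ (_ , _ , inj₂ (_ , _ , suc _ , _ , _ , _ , _ , r) , _) = inj₂ (_ , r)

    ex₀⊥Q : Disjoint exComposition₀ (idOn Q)
    ex₀⊥Q = (λ { ((_ , x∉ , _) , (_ , q , _)) → notCodom x∉ (Q⊆ q) })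
          , (λ { ((_ , _ , y∉ , _) , (_ , q , refl)) → notDom y∉ (Q⊆ q) })
      where
      g = f + f ⋆ by f⊥f⋆
      notCodom : ∀ {x} → x ∉ codom g → x ∉ dom f ∪ codom f
      notCodom x∉ (inj₁ (_ , p)) = x∉ (_ , inj₂ p)
      notCodom x∉ (inj₂ (_ , p)) = x∉ (_ , inj₁ p)
      notDom : ∀ {x} → x ∉ dom g → x ∉ dom f ∪ codom f
      notDom x∉ (inj₁ (_ , p)) = x∉ (_ , inj₁ p)
      notDom x∉ (inj₂ (_ , p)) = x∉ (_ , inj₂ p)

  exComposition : PartialInjection
  exComposition = exComposition₀ + idOn Q by ex₀⊥Q

open ExComposition public using (exComposition)

------------------------------------------------------------------------
-- Nets

record Signature : Set₁ where
  field
    Symbol    : Set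
    countable : Symbol ↣ ℕ
    ar        : Symbol → ℕ

open Signature public

-- The partial permutation σ_c together with the chosen element and the
-- label of each of its orbits; data attached to orbits is given as a
-- function on dom σ_c that is constant on orbits.
record Cells (S : Signature) : Set (lsuc 0ℓ) where
  field
    σc              : PartialInjection
    isPermutation   : IsPartialPermutation σc
    chosen          : ∀ {x} → x ∈ dom σc → ℕ
    chosen-constant : ∀ {x y} (p : x ∈ dom σc) (q : y ∈ dom σc) →
                      y ∈ Orbit σc x → chosen p ≡ chosen q
    chosen∈orbit    : ∀ {x} (p : x ∈ dom σc) → chosen p ∈ Orbit σc x
    label           : ∀ {x} → x ∈ dom σc → Symbol S
    label-constant  : ∀ {x y} (p : x ∈ dom σc) (q : y ∈ dom σc) →
                      y ∈ Orbit σc x → label p ≡ label q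
    orbit-size      : ∀ {x} (p : x ∈ dom σc) →
                      HasSize (Orbit σc x) (suc (ar S (label p)))

open Cells public using (σc; chosen; label)

record _≈ᶜ_ {S : Signature} (C D : Cells S) : Set where
  field
    σc≈     : σc C ≈ σc D
    chosen≈ : ∀ {x} (p : x ∈ dom (σc C)) (q : x ∈ dom (σc D)) →
              chosen C p ≡ chosen D q
    label≈  : ∀ {x} (p : x ∈ dom (σc C)) (q : x ∈ dom (σc D)) →
              label C p ≡ label D q

record InteractionNet (S : Signature) : Set (lsuc 0ℓ) where
  field
    σw             : PartialInjection
    σw-wPerm       : IsWPermutation σw
    cells          : Cells S

  P : Pred ℕ 0ℓ
  P x = x ∈ dom σw × x ∉ FixedPoints σw

  field
    cells⊆P        : dom (σc cells) ⊆ P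

record ACNet (S : Signature) : Set (lsuc 0ℓ) where
  field
    σA σC      : PartialInjection
    σA-wPerm   : IsWPermutation σA
    σC-wPerm   : IsWPermutation σC
    domσC⊆     : dom σC ⊆ dom σA
    σC-noFixed : ∀ {x} → x ∉ FixedPoints σC
    cuts       : ∀ {a b} → IsOrbit₂ σC a b → ∃₂ λ c d →
                 c ≢ a × d ≢ b × IsOrbit₂ σA c a × IsOrbit₂ σA b d
    cells      : Cells S

  Pₗ : Pred ℕ 0ℓ
  Pₗ = FixedPoints σA

  P : Pred ℕ 0ℓ
  P x = x ∈ dom σA × x ∉ dom σC × x ∉ Pₗ

  field
    cells⊆P    : dom (σc cells) ⊆ P

record _≈ᴬ_ {S : Signature} (M N : ACNet S) : Set where
  private
    module M = ACNet M
    module N = ACNet N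
  field
    σA≈    : M.σA ≈ N.σA
    σC≈    : M.σC ≈ N.σC
    cells≈ : M.cells ≈ᶜ N.cells

------------------------------------------------------------------------
-- Ex-collapse

record Relocates {S : Signature} (f : PartialInjection) (N : ACNet S) : Set where
  private module N = ACNet N
  field
    dom≐   : dom f ≐ dom N.σC
    codom⊥ : codom f ⊥ dom N.σA

  τ : PartialInjection
  τ = f ∘ N.σC ∘ f ⋆

  composable : Composable N.σA τ f
  composable = record
    { disjoint = (λ { (p , (_ , (_ , (_ , q , _) , _))) → codom⊥ ((_ , q) , p) })
               , (λ { (p , (_ , (_ , _ , q))) →
                      codom⊥ ((_ , q) , proj₂ σA-perm p) })
    ; dom⊆     = λ p → N.domσC⊆ (proj₁ dom≐ p)
    ; codom⊆   = λ (x , p) →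
        let (y , q) = proj₁ dom≐ (_ , p)
            (_ , r) = proj₂ dom≐ (proj₂ σC-perm (_ , q))
        in _ , (_ , (_ , p , q) , r)
    }
    where
    σA-perm = IsWPermutation.isPartialPermutation N.σA-wPerm
    σC-perm = IsWPermutation.isPartialPermutation N.σC-wPerm

-- R is the Ex-collapse of N. For σC ≠ 0 the result may depend on f (through
-- the minima of the double orbits), hence a relation between N and R.
record IsExCollapse {S : Signature} (N : ACNet S) (R : InteractionNet S) :
                    Set₁ where
  private
    module N = ACNet N
    module R = InteractionNet R
  field
    f         : PartialInjection
    relocates : Relocates f N
  open Relocates relocates
  field
    σw≈    : R.σw ≈ exComposition N.σA τ f composable
    cells≈ : R.cells ≈ᶜ N.cells

{-# OPTIONS --safe #-}
module Submission where

open import Defs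
open import Data.Empty using (⊥-elim)
open import Data.List.Base using ([])
open import Data.List.Relation.Unary.AllPairs using ([])
open import Data.Nat.Base using (zero; suc)
open import Data.Product using (∃!; _×_; _,_; proj₁; swap)
open import Data.Sum.Base using (inj₁; inj₂)
open import Function.Base using (id)
open import Function.Bundles using (mk⇔)
open import Relation.Binary.PropositionalEquality using (refl)
open import Relation.Unary using (Empty)

-- If `σC` is empty, then so are `f`, whose domain is that of `σC`, and the conjugate `τ` of `σC` by
-- `f`. Execution then leaves `σA` as it is and no double orbit adds a fixed point, so the collapse
-- is `σA` with the same cells, whatever `f` is (`collapse-cutFree`). Hence `R` read as a net
-- without cuts collapses to `R`, and any other cut-free net collapsing to `R` has the same `σA` and
-- the same cells.

≈-trans : ∀ {f g h} → f ≈ g → g ≈ h → f ≈ h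
≈-trans (p , q) (r , s) = (λ a → r (p a)) , (λ a → q (s a))

-- Without f and τ every path in the execution is a single step of σ, and there
-- are no double orbits.
module _ {σ τ f : PartialInjection} (c : Composable σ τ f)
         (f-empty : Empty (dom f)) (τ-empty : Empty (dom τ)) where

  exComposition-empty : exComposition σ τ f c ≈ σ
  exComposition-empty = to , from
    where
    to : ∀ {x y} → graph (exComposition σ τ f c) x y → graph σ x y
    to (inj₁ (_ , _ , zero , _ , refl , inj₁ p)) = p
    to (inj₁ (_ , _ , zero , _ , refl , inj₂ p)) = ⊥-elim (τ-empty _ (_ , p))
    to (inj₁ (_ , _ , suc _ , _ , (_ , _ , _ , _ , inj₁ p) , _)) =
      ⊥-elim (f-empty _ (_ , p))
    to (inj₁ (_ , _ , suc _ , _ , (_ , _ , _ , _ , inj₂ p) , _)) =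
      ⊥-elim (f-empty _ (_ , p))
    to (inj₂ ((_ , (x∈ , _) , _) , _)) = ⊥-elim (f-empty _ x∈)

    from : ∀ {x y} → graph σ x y → graph (exComposition σ τ f c) x y
    from p = inj₁
      ( (λ { (_ , inj₁ q) → f-empty _ (_ , q) ; (_ , inj₂ q) → f-empty _ (_ , q) })
      , (λ { (_ , inj₁ q) → f-empty _ (_ , q) ; (_ , inj₂ q) → f-empty _ (_ , q) })
      , zero , _ , refl , inj₁ p )

𝟘-wPerm : IsWPermutation 𝟘
𝟘-wPerm = record
  { isPartialPermutation = (λ ()) , (λ ())
  ; involutive           = λ ()
  ; finite               = zero , [] , [] , refl , λ _ → mk⇔ (λ ()) (λ ())
  }

module _ {S : Signature} where

  -- `chosen` and `label` take a membership proof as argument, so even reflexivity compares two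
  -- proofs for one `x`. As `x` lies in its own orbit by the zeroth power, constancy on orbits
  -- applies.
  ≈ᶜ-refl : (C : Cells S) → C ≈ᶜ C
  ≈ᶜ-refl C = record
    { σc≈     = id , id
    ; chosen≈ = λ p q → Cells.chosen-constant C p q (zero , refl)
    ; label≈  = λ p q → Cells.label-constant C p q (zero , refl)
    }

  cutFree : InteractionNet S → ACNet S
  cutFree R = record
    { σA         = σw
    ; σC         = 𝟘
    ; σA-wPerm   = σw-wPerm
    ; σC-wPerm   = 𝟘-wPerm
    ; domσC⊆     = λ ()
    ; σC-noFixed = λ ()
    ; cuts       = λ ()
    ; cells      = cells
    -- With no cuts, `P` of the AC net is again the set of non-fixed points of `σw`.
    ; cells⊆P    = λ p → let (x∈ , x∉) = cells⊆P p in x∈ , (λ ()) , x∉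
    }
    where open InteractionNet R

  cutFree-relocates : (R : InteractionNet S) → Relocates 𝟘 (cutFree R)
  cutFree-relocates R = record { dom≐ = id , id ; codom⊥ = λ () }

  module _ (N : ACNet S) (σC≈𝟘 : ACNet.σC N ≈ 𝟘)
           {f : PartialInjection} (r : Relocates f N) where
    open ACNet N
    open Relocates r

    -- Stated for any `σC` with empty graph and any relocation, so that it serves both existence and
    -- uniqueness.
    collapse-cutFree : exComposition σA τ f composable ≈ σA
    collapse-cutFree = exComposition-empty composable f-empty
      (λ { _ (_ , (_ , (_ , _ , p) , _)) → proj₁ σC≈𝟘 p })
      where
      f-empty : Empty (dom f)
      f-empty _ p = let (_ , q) = proj₁ dom≐ p in proj₁ σC≈𝟘 q

proposition6p4 : (S : Signature) (R : InteractionNet S) →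
    ∃! _≈ᴬ_ (λ (R′ : ACNet S) → ACNet.σC R′ ≈ 𝟘 × IsExCollapse R′ R)
proposition6p4 S R = cutFree R , (((λ ()) , (λ ())) , collapses) , unique
  where
  open InteractionNet R using (σw; cells)

  collapses : IsExCollapse (cutFree R) R
  collapses = record
    { f         = 𝟘
    ; relocates = cutFree-relocates R
    ; σw≈       = swap (collapse-cutFree (cutFree R) ((λ ()) , (λ ())) (cutFree-relocates R))
    ; cells≈    = ≈ᶜ-refl cells
    }

  unique : ∀ {N} → ACNet.σC N ≈ 𝟘 × IsExCollapse N R → cutFree R ≈ᴬ N
  unique {N} (σC≈𝟘 , c) = record
    -- The composition along the relocation supplied by `c` equals `σw` by hypothesis and `σA` by
    -- the lemma.
    { σA≈    = ≈-trans {σw} {exComposition σA τ f composable} {σA}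
                 σw≈ (collapse-cutFree N σC≈𝟘 relocates)
    ; σC≈    = swap σC≈𝟘
    ; cells≈ = cells≈
    }
    where
    open ACNet N using (σA)
    open IsExCollapse c
    open Relocates relocates
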